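{- The number of locally-valid MV assignments of any $m\times n$ snake tessellation is equal to the number of locally-valid MV assignments of an $m\times n$ standard Miura-ori, and also to that of an $m\times n$ modified Miura-ori.
   Context: **Modified Miura-ori.** An $m\times n$ modified Miura-ori crease pattern is formed by $m-1$ straight horizontal crease lines crossed by $n-1$ vertical zig-zag columns of creases. In coordinates: the horizontal creases lie on the lines $y=i$, $1\le i\le m-1$, of the paper $P$ with $0\le y\le m$; for $1\le j\le n-1$ the $j$-th zig-zag is the polyline through the points $p_{i,j}=(x_j+\epsilon_j(-1)^i\delta,\; i)$, $i=0,\dots,m$, where $\delta>0$, $\epsilon_j\in\{1,-1\}$, and $x_1<\cdots<x_{n-1}$ are spaced so that the zig-zags are pairwise disjoint and interior to the left and right edges of $P$. The interior vertices are the $p_{i,j}$ with $1\le i\le m-1$, $1\le j\le n-1$; the creases are the segments into which the horizontal lines and zig-zags are cut by these vertices. The standard Miura-ori is the case where all $\epsilon_j$ are equal; a modified Miura-ori has arbitrary signs $\epsilon_j$ (some zig-zag columns reflected left to right). Every interior vertex is a bird's foot: two consecutive equal acute sector angles $\theta$ bordered by three creases (the toes), and two equal obtuse sector angles $\pi-\theta$ meeting at the fourth crease (the heel, collinear with the middle toe). **Snake tessellation.** An $m\times n$ snake tessellation is a crease pattern defined in the same way, except that some pairs of consecutive zig-zags $j,j+1$ with $\epsilon_{j+1}=-\epsilon_j$ are moved together until they touch ($x_{j+1}-x_j=2\delta$), so that at every row $i$ with $\epsilon_j(-1)^i=1$ the two bird's feet $p_{i,j}$ and $p_{i,j+1}$,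 which in the corresponding modified Miura-ori share a common heel, coincide and form a single degree-6 vertex (a waterbomb vertex), the shared heel having been contracted away. A waterbomb vertex thus has cyclic sector angles $\theta,\theta,\pi-2\theta,\theta,\theta,\pi-2\theta$ with $\theta<\pi-2\theta$; the two triples of creases $\{w_1,w_2,w_3\}$ and $\{w_4,w_5,w_6\}$ bordering the two pairs of consecutive angles $\theta$ are the toes of the two merged bird's feet. All other interior vertices are bird's feet. Splitting each waterbomb vertex into two bird's feet sharing a heel gives the corresponding $m\times n$ modified Miura-ori. **MV assignments.** A MV assignment is a function $\mu$ from the set of creases to $\{1,-1\}$ (mountain $=1$, valley $=-1$). It is locally-valid if at each interior vertex the creases at that vertex fold flat without self-intersection. Known characterization: a bird's foot is validly assigned iff $\mu(\text{heel})$ equals the sum of $\mu$ over the three toes; a waterbomb vertex is validly assigned iff $\mu(w_1)+\mu(w_2)+\mu(w_3)=\pm1$, $\mu(w_4)+\mu(w_5)+\mu(w_6)=\pm1$, and $\sum_{i=1}^6\mu(w_i)=\pm2$. -}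

module Defs where

open import Data.Fin.Base using (Fin; suc; toℕ; inject₁)
open import Data.Fin.Properties using (inject₁-injective; suc-injective)
open import Data.Fin.Subset using (Subset; _∈_; ⊥)
open import Data.Fin.Subset.Properties using (∉⊥)
open import Data.Integer.Base using (ℤ; -_; _+_; _◃_; 1ℤ; +_)
open import Data.Nat.Base using (ℕ; suc; pred; parity)
open import Data.Parity.Base using (toSign)
open import Data.Product.Base using (Σ; ∃-syntax; _×_; _,_; proj₁)
open import Data.Sign.Base as Sign using (Sign; opposite)
open import Data.Sum.Base using (_⊎_)
open import Function.Bundles using (Inverse)
open import Level using (0ℓ)
open import Relation.Binary.Bundles using (Setoid)
open import Relation.Binary.PropositionalEquality
  using (_≡_; refl; sym; trans; cong; setoid; _→-setoid_)
import Relation.Binary.Construct.On as On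
open import Relation.Nullary.Negation using (¬_; contradiction)

-- Among k things in a line there are pred k pairs of consecutive ones;
-- pair p consists of  lo p  and  hi p,  the latter one step further.

lo hi : ∀ {k} → Fin (pred k) → Fin k
lo {suc k} p = inject₁ p
hi {suc k} p = suc p

lo-injective : ∀ {k} {p q : Fin (pred k)} → lo {k} p ≡ lo q → p ≡ q
lo-injective {suc k} = inject₁-injective

hi-injective : ∀ {k} {p q : Fin (pred k)} → hi {k} p ≡ hi q → p ≡ q
hi-injective {suc k} = suc-injective

lo∘hi≡hi∘lo : ∀ {k} (p : Fin (pred (pred k))) → lo {k} (hi p) ≡ hi (lo p)
lo∘hi≡hi∘lo {suc (suc k)} p = refl

-- The combinatorial type of an m × n snake tessellation.  All coordinates are
-- determined by it up to the choice of δ and of the other gaps between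
-- zig-zags, and these do not affect creases, vertices or their types.
--
-- Indices count from zero:  i : Fin (pred m)  is the horizontal line
-- y = suc (toℕ i),  j : Fin (pred n)  is a zig-zag (from left to right), and
-- p : Fin (pred (pred n))  is the pair of zig-zags  lo p , hi p.

record SnakeTessellation (m n : ℕ) : Set where
  field
    ε        : Fin (pred n) → Sign
    touching : Subset (pred (pred n))
    reflected : ∀ p → p ∈ touching → ε (hi p) ≡ opposite (ε (lo p))

  -- The zig-zag turns at p_{i,j} = (x_j + ε_j (-1)^y δ , y), both of its creases
  -- leaving towards the side -ε_j (-1)^y.  Hence the heel leaves towards the
  -- side ε_j (-1)^y, where Sign.+ means right and Sign.- means left.
  heelSide : Fin (pred m) → Fin (pred n) → Sign
  heelSide i j = ε j Sign.* toSign (parity (suc (toℕ i)))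

  -- Waterbomb i p : on line i the zig-zags of the pair p meet in a waterbomb vertex.
  Waterbomb : Fin (pred m) → Fin (pred (pred n)) → Set
  Waterbomb i p = p ∈ touching × heelSide i (lo p) ≡ Sign.+

  -- The zig-zags cut a horizontal line into n pieces, indexed by Fin n; zig-zag j
  -- has the piece  lo j  on its left and  hi j  on its right.  The piece between
  -- the zig-zags of a pair p is therefore  hi (lo p)  (equivalently  lo (hi p)).
  Contracted : Fin (pred m) → Fin n → Set
  Contracted i k = ∃[ p ] Waterbomb i p × k ≡ hi (lo p)

  beside : Sign → Fin (pred n) → Fin n
  beside Sign.- = lo
  beside Sign.+ = hi

  heelPiece middleToePiece : Fin (pred m) → Fin (pred n) → Fin n
  heelPiece      i j = beside (heelSide i j) j
  middleToePiece i j = beside (opposite (heelSide i j)) j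

  -- zigzag j t  is the crease of zig-zag j from y = toℕ t to y = suc (toℕ t).
  -- Irrelevance of the last argument of  horizontal  ensures that a piece of a
  -- horizontal line is counted as a single crease.
  data Crease : Set where
    zigzag     : (j : Fin (pred n)) (t : Fin m) → Crease
    horizontal : (i : Fin (pred m)) (k : Fin n) → .(¬ Contracted i k) → Crease

  heelSide-hi : ∀ i p → Waterbomb i p → heelSide i (hi p) ≡ Sign.-
  heelSide-hi i p (p∈ , eq) = trans
    (cong (Sign._* toSign (parity (suc (toℕ i)))) (reflected p p∈))
    (opp (ε (lo p)) (toSign (parity (suc (toℕ i)))) eq)
    where
    opp : ∀ s t → s Sign.* t ≡ Sign.+ → opposite s Sign.* t ≡ Sign.-
    opp Sign.- Sign.- _ = refl
    opp Sign.+ Sign.+ _ = refl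

  toeSide-not-contracted : ∀ i j s → heelSide i j ≡ s → ¬ Contracted i (beside (opposite s) j)
  toeSide-not-contracted i j Sign.- eq (p , (_ , eq′) , k≡)
    = contradiction (trans (sym eq) (trans (cong (heelSide i) j≡) eq′)) λ ()
    where
    j≡ : j ≡ lo p
    j≡ = hi-injective {n} k≡
  toeSide-not-contracted i j Sign.+ eq (p , wb , k≡)
    = contradiction (trans (sym eq) (trans (cong (heelSide i) j≡) (heelSide-hi i p wb))) λ ()
    where
    j≡ : j ≡ hi p
    j≡ = lo-injective {n} (trans k≡ (sym (lo∘hi≡hi∘lo {n} p)))

  middleToe-not-contracted : ∀ i j → ¬ Contracted i (middleToePiece i j)
  middleToe-not-contracted i j = toeSide-not-contracted i j (heelSide i j) refl

  -- Sign.+ is mountain, Sign.- is valley.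
  MVAssignment : Set
  MVAssignment = Crease → Sign

  value : MVAssignment → Crease → ℤ
  value μ c = μ c ◃ 1

  -- The bird's foot at p_{i,j}, whether or not it is merged into a waterbomb vertex.
  toeSum : MVAssignment → Fin (pred m) → Fin (pred n) → ℤ
  toeSum μ i j = value μ (zigzag j (lo i))
               + value μ (horizontal i (middleToePiece i j) (middleToe-not-contracted i j))
               + value μ (zigzag j (hi i))

  infix 4 _≡±_
  _≡±_ : ℤ → ℤ → Set
  x ≡± y = x ≡ y ⊎ x ≡ - y

  -- The flat-foldability criteria for the two kinds of vertices.  p_{i,j} is a
  -- vertex of its own, i.e. a bird's foot, exactly when its heel has not been
  -- contracted.
  BirdsFootValid : MVAssignment → (i : Fin (pred m)) (j : Fin (pred n)) →
                   ¬ Contracted i (heelPiece i j) → Set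
  BirdsFootValid μ i j heel = value μ (horizontal i (heelPiece i j) heel) ≡ toeSum μ i j

  WaterbombValid : MVAssignment → Fin (pred m) → Fin (pred (pred n)) → Set
  WaterbombValid μ i p = toeSum μ i (lo p) ≡± 1ℤ
                       × toeSum μ i (hi p) ≡± 1ℤ
                       × toeSum μ i (lo p) + toeSum μ i (hi p) ≡± (+ 2)

  LocallyValid : MVAssignment → Set
  LocallyValid μ = (∀ i j heel → BirdsFootValid μ i j heel)
                 × (∀ i p → Waterbomb i p → WaterbombValid μ i p)

  -- Assignments are compared pointwise, ignoring the proofs of local validity.
  LocallyValidAssignments : Setoid 0ℓ 0ℓ
  LocallyValidAssignments =
    On.setoid {B = Σ MVAssignment LocallyValid} (Crease →-setoid Sign) proj₁

open SnakeTessellation using (LocallyValidAssignments) public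

modifiedMiura : ∀ m {n} → (Fin (pred n) → Sign) → SnakeTessellation m n
modifiedMiura m ε = record
  { ε         = ε
  ; touching  = ⊥
  ; reflected = λ _ p∈⊥ → contradiction p∈⊥ ∉⊥
  }

-- The modified Miura-ori with these signs is a standard Miura-ori.
AllEqual : ∀ {k} → (Fin k → Sign) → Set
AllEqual ε = ∀ j j′ → ε j ≡ ε j′

infix 4 _HasCardinality_
_HasCardinality_ : Setoid 0ℓ 0ℓ → ℕ → Set
S HasCardinality N = Inverse S (setoid (Fin N))

{-# OPTIONS --safe #-}

-- Let a and b be the zig-zag creases below and above p_{i,j}, and l and r the
-- pieces of the horizontal line on its left and right.  The bird's-foot condition
-- is r = a + l + b or l = a + r + b, according to the side of the heel, and
-- reflecting the foot amounts to changing the signs of a and b.  Hence negating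
-- the creases of all zig-zags j with ε j = - turns the locally-valid assignments
-- of any modified Miura-ori into those of the one with ε = +.  A waterbomb vertex
-- is valid exactly when its two toe sums are equal and ±1; that common value is
-- the only possible one for the shared heel once the vertex has been split, so a
-- snake tessellation has the same assignments as its modified Miura-ori.

module Submission where

open import Defs
open import Data.Empty using (⊥-elim-irr)
open import Data.Fin.Base using (Fin; zero; suc; toℕ; combine; funToFin; finToFun)
open import Data.Fin.Properties
  using (_≟_; any?; all?; +↔⊎; *↔×; funToFin-finToFin; finToFun-funToFin)
open import Data.Fin.Subset.Properties using (_∈?_)
open import Data.Integer.Base using (ℤ; -_; _+_; _◃_; sign)
open import Data.Integer.Properties as ℤ using (sign-◃)
open import Data.Integer.Tactic.RingSolver using (solve-∀)
open import Data.Nat.Base as ℕ using (ℕ; suc; pred; parity; NonZero)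
open import Data.Parity.Base using (toSign)
open import Data.Product.Base using (Σ; ∃-syntax; _×_; _,_; proj₁; proj₂)
open import Data.Sign.Base as Sign using (Sign; opposite)
import Data.Sign.Properties as Sign
open import Data.Sum.Base using (_⊎_; inj₁; inj₂)
open import Data.Sum.Function.Propositional using (_⊎-↔_)
open import Function.Base using (_∘_; _$_; id)
open import Function.Bundles using (Inverse; _↔_; mk↔ₛ′)
open import Function.Construct.Composition using () renaming (inverse to compose)
open import Function.Properties.Inverse using (↔-trans)
open import Level using (0ℓ)
open import Relation.Binary.Bundles using (Setoid)
open import Relation.Binary.PropositionalEquality
  using (_≡_; refl; sym; trans; cong; cong₂; subst; setoid; _→-setoid_; _≗_)
import Relation.Binary.Construct.On as On
open import Relation.Nullary.Decidable using (Dec; yes; no; _×-dec_)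
open import Relation.Nullary.Negation using (¬_; contradiction)
open import Relation.Unary using (Pred; Decidable)

-- Finite setoids

Restrict : (S : Setoid 0ℓ 0ℓ) → Pred (Setoid.Carrier S) 0ℓ → Setoid 0ℓ 0ℓ
Restrict S P = On.setoid {B = Σ (Setoid.Carrier S) P} S proj₁

-- Equality in `Restrict` ignores the proofs, so the inverse laws of `I` carry over unchanged.
restrict-inverse : ∀ {S T} {P : Pred (Setoid.Carrier S) 0ℓ} {Q : Pred (Setoid.Carrier T) 0ℓ}
  (I : Inverse S T) →
  (∀ {x} → P x → Q (Inverse.to I x)) → (∀ {y} → Q y → P (Inverse.from I y)) →
  Inverse (Restrict S P) (Restrict T Q)
restrict-inverse I P⇒Q Q⇒P = record
  { to        = λ (x , p) → to x , P⇒Q p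
  ; from      = λ (y , q) → from y , Q⇒P q
  ; to-cong   = to-cong
  ; from-cong = from-cong
  ; inverse   = inverseˡ , inverseʳ
  }
  where open Inverse I

-- Induction on `k`: the element `zero` is either dropped or receives the new index `zero`.
count : ∀ {k} {P : Pred (Fin k) 0ℓ} → Decidable P →
        ∃[ N ] Restrict (setoid (Fin k)) P HasCardinality N
count {ℕ.zero} P? = 0 , record
  { to = λ () ; from = λ () ; to-cong = λ { {() , _} } ; from-cong = λ { {()} }
  ; inverse = (λ { {()} }) , λ { {() , _} } }
count {suc k} P? with P? zero | count (P? ∘ suc)
... | no ¬p | N , I = N , record
  { to        = λ { (zero , p) → contradiction p ¬p ; (suc i , p) → to (i , p) }
  ; from      = λ y → suc (proj₁ (from y)) , proj₂ (from y)
  ; to-cong   = λ { {zero , p} _ → contradiction p ¬p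
                  ; {suc _ , _} {suc _ , _} refl → to-cong refl }
  ; from-cong = λ { refl → refl }
  ; inverse   = (λ { refl → inverseˡ refl })
              , λ { {zero , p} _ → contradiction p ¬p
                  ; {suc _ , _} refl → cong suc (inverseʳ refl) }
  }
  where open Inverse I
... | yes p | N , I = suc N , record
  { to        = λ { (zero , _) → zero ; (suc i , q) → suc (to (i , q)) }
  ; from      = λ { zero → zero , p ; (suc y) → suc (proj₁ (from y)) , proj₂ (from y) }
  ; to-cong   = λ { {zero , _} {zero , _} _ → refl
                  ; {suc _ , _} {suc _ , _} refl → cong suc (to-cong refl) }
  ; from-cong = λ { refl → refl }
  ; inverse   = (λ { {zero} {zero , _} _ → refl
                   ; {suc _} {suc _ , _} refl → cong suc (inverseˡ refl) })
              , λ { {zero , _} refl → refl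
                  ; {suc _ , _} refl → cong suc (inverseʳ refl) }
  }
  where open Inverse I

functions : ∀ {A B : Set} {a b} → Fin a ↔ A → Fin b ↔ B →
            (A →-setoid B) HasCardinality (b ℕ.^ a)
functions {a = a} {b} IA IB = record
  { to        = λ f → funToFin (B.from ∘ f ∘ A.to)
  ; from      = λ y → B.to ∘ finToFun y ∘ A.from
  ; to-cong   = λ f≗g → funToFin-cong (cong B.from ∘ f≗g ∘ A.to)
  ; from-cong = λ { refl _ → refl }
  ; inverse   = (λ {y} f≗ → trans (funToFin-cong λ i →
                    trans (B.inverseʳ (f≗ (A.to i))) (cong (finToFun y) (A.strictlyInverseʳ i)))
                    (funToFin-finToFin {a} {b} y))
              , λ { {f} refl x → trans
                    (B.inverseˡ (finToFun-funToFin (B.from ∘ f ∘ A.to) (A.from x)))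
                    (cong f (A.strictlyInverseˡ x)) }
  }
  where
  module A = Inverse IA
  module B = Inverse IB
  funToFin-cong : ∀ {a b} {f g : Fin a → Fin b} → f ≗ g → funToFin f ≡ funToFin g
  funToFin-cong {ℕ.zero} _   = refl
  funToFin-cong {suc a}  f≗g =
    cong₂ combine (f≗g zero) (funToFin-cong (f≗g ∘ suc))

2↔Sign : Fin 2 ↔ Sign
2↔Sign = mk↔ₛ′ (λ { zero → Sign.+ ; (suc zero) → Sign.- })
  (λ { Sign.+ → zero ; Sign.- → suc zero })
  (λ { Sign.+ → refl ; Sign.- → refl })
  (λ { zero → refl ; (suc zero) → refl })

count-functions : ∀ {A : Set} {a} → Fin a ↔ A → {P : Pred (A → Sign) 0ℓ} →
  (∀ {f g} → f ≗ g → P f → P g) → Decidable P →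
  ∃[ N ] Restrict (A →-setoid Sign) P HasCardinality N
count-functions IA {P} P-resp P? =
  let N , J = count (P? ∘ from) in
  -- Decoding the code of `f` returns a function only pointwise equal to `f`, hence the appeal to
  -- `P-resp`.
  N , compose (restrict-inverse I (λ {f} → P-resp (sym ∘ strictlyInverseʳ f)) id) J
  where
  I = functions IA 2↔Sign
  open Inverse I

-- Bird's feet

⟦_⟧ : Sign → ℤ
⟦ s ⟧ = s ◃ 1

-- The first argument is the side of the heel, with the convention of `heelSide`.
Foot : Sign → (l r a b : Sign) → Set
Foot Sign.+ l r a b = ⟦ r ⟧ ≡ ⟦ a ⟧ + ⟦ l ⟧ + ⟦ b ⟧
Foot Sign.- l r a b = ⟦ l ⟧ ≡ ⟦ a ⟧ + ⟦ r ⟧ + ⟦ b ⟧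

foot? : ∀ s l r a b → Dec (Foot s l r a b)
foot? Sign.+ l r a b = _ ℤ.≟ _
foot? Sign.- l r a b = _ ℤ.≟ _

-- Solving x = a + y + b for y gives y = -a + x - b: heel and middle toe exchange roles once both
-- zig-zag creases are negated.
foot-reflect : ∀ s {l r a b} → Foot (opposite s) l r a b → Foot s l r (opposite a) (opposite b)
foot-reflect s {l} {r} {a} {b} = go s
  where
  ⟦opposite⟧ : ∀ s → ⟦ opposite s ⟧ ≡ - ⟦ s ⟧
  ⟦opposite⟧ Sign.+ = refl
  ⟦opposite⟧ Sign.- = refl
  cancel : ∀ x y z → y ≡ - x + (x + y + z) + - z
  cancel = solve-∀
  solve-for : ∀ x y → ⟦ x ⟧ ≡ ⟦ a ⟧ + ⟦ y ⟧ + ⟦ b ⟧ →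
              ⟦ y ⟧ ≡ ⟦ opposite a ⟧ + ⟦ x ⟧ + ⟦ opposite b ⟧
  solve-for x y eq rewrite ⟦opposite⟧ a | ⟦opposite⟧ b | eq = cancel ⟦ a ⟧ ⟦ y ⟧ ⟦ b ⟧
  go : ∀ s → Foot (opposite s) l r a b → Foot s l r (opposite a) (opposite b)
  go Sign.+ = solve-for l r
  go Sign.- = solve-for r l

foot-* : ∀ u s {l r a b} → Foot (u Sign.* s) l r a b → Foot s l r (u Sign.* a) (u Sign.* b)
foot-* Sign.+ s foot = foot
foot-* Sign.- s foot = foot-reflect s foot

*-involutive : ∀ u s → u Sign.* (u Sign.* s) ≡ s
*-involutive Sign.+ s = refl
*-involutive Sign.- s = Sign.opposite-involutive s

-- inj₁ (j , t)  stands for  zigzag j t,  inj₂ (i , k)  for piece k of horizontal line i.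
Grid : ℕ → ℕ → Set
Grid m n = (Fin (pred n) × Fin m) ⊎ (Fin (pred m) × Fin n)

-- The local conditions of the modified Miura-ori with signs `ε`: no piece is contracted and every
-- p_{i,j} is a bird's foot.
Feet : ∀ m n → (Fin (pred n) → Sign) → Pred (Grid m n → Sign) 0ℓ
Feet m n ε G = ∀ i j → Foot (ε j Sign.* toSign (parity (suc (toℕ i))))
  (G (inj₂ (i , lo j))) (G (inj₂ (i , hi j))) (G (inj₁ (j , lo i))) (G (inj₁ (j , hi i)))

FeetSetoid : ∀ m n → (Fin (pred n) → Sign) → Setoid 0ℓ 0ℓ
FeetSetoid m n ε = Restrict (Grid m n →-setoid Sign) (Feet m n ε)

count-feet : ∀ m n ε → ∃[ N ] FeetSetoid m n ε HasCardinality N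
count-feet m n ε = count-functions grid feet-resp (λ G → all? λ i → all? λ j → foot? _ _ _ _ _)
  where
  grid : Fin (pred n ℕ.* m ℕ.+ pred m ℕ.* n) ↔ Grid m n
  grid = ↔-trans +↔⊎ (*↔× ⊎-↔ *↔×)
  feet-resp : ∀ {G H} → G ≗ H → Feet m n ε G → Feet m n ε H
  feet-resp G≗H feet i j = subst id
    (cong₂ _$_ (cong₂ _$_ (cong₂ (Foot _) (G≗H _) (G≗H _)) (G≗H _)) (G≗H _)) (feet i j)

reflect : ∀ m n ε → Inverse (FeetSetoid m n ε) (FeetSetoid m n (λ _ → Sign.+))
reflect m n ε = restrict-inverse record
    { to        = flip
    ; from      = flip
    ; to-cong   = flip-cong
    ; from-cong = flip-cong
    ; inverse   = flip-inverse , flip-inverse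
    }
  (λ feet i j → foot-* (ε j) _ (feet i j))
  -- The two factors `ε j` cancel, so the foot with heel sign + may be read as one reflected twice.
  (λ feet i j → foot-* (ε j) _
    (subst (λ s → Foot s _ _ _ _) (sym (*-involutive (ε j) _)) (feet i j)))
  where
  flip : (Grid m n → Sign) → Grid m n → Sign
  flip G (inj₁ (j , t)) = ε j Sign.* G (inj₁ (j , t))
  flip G (inj₂ x)       = G (inj₂ x)
  flip-cong : ∀ {G H} → G ≗ H → flip G ≗ flip H
  flip-cong G≗H (inj₁ (j , t)) = cong (ε j Sign.*_) (G≗H _)
  flip-cong G≗H (inj₂ x)       = G≗H _
  flip-inverse : ∀ {G H} → H ≗ flip G → flip H ≗ G
  flip-inverse H≗ (inj₁ (j , t)) = trans (cong (ε j Sign.*_) (H≗ _)) (*-involutive (ε j) _)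
  flip-inverse H≗ (inj₂ x)       = H≗ _

-- Splitting the waterbomb vertices

module Split {m n : ℕ} (S : SnakeTessellation m n) where
  open SnakeTessellation S hiding (LocallyValidAssignments)

  contracted? : ∀ i k → Dec (Contracted i k)
  contracted? i k = any? λ p → ((p ∈? touching) ×-dec (heelSide i (lo p) Sign.≟ Sign.+))
                               ×-dec (k ≟ hi (lo p))

  -- On a contracted piece this is the value of the restored heel. Taking the left foot is a mere
  -- choice: at a valid waterbomb vertex both toe sums agree and are ±1, so `sign` loses nothing.
  piece : MVAssignment → Fin (pred m) → Fin n → Sign
  piece μ i k with contracted? i k
  ... | yes (p , _) = sign (toeSum μ i (lo p))
  ... | no  present = μ (horizontal i k present)

  piece-present : ∀ μ i k .(present : ¬ Contracted i k) → piece μ i k ≡ μ (horizontal i k present)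
  piece-present μ i k present with contracted? i k
  -- `present` is irrelevant, so the contradiction has to be eliminated irrelevantly.
  ... | yes c = ⊥-elim-irr (present c)
  ... | no  _ = refl

  piece-cong : ∀ {μ ν} → μ ≗ ν → ∀ i k → piece μ i k ≡ piece ν i k
  piece-cong {μ} {ν} μ≗ν i k with contracted? i k
  ... | yes (p , _) = cong sign (toeSum-cong i (lo p))
    where
    toeSum-cong : ∀ i j → toeSum μ i j ≡ toeSum ν i j
    toeSum-cong i j = cong₂ _+_
      (cong₂ _+_ (cong ⟦_⟧ (μ≗ν _)) (cong ⟦_⟧ (μ≗ν _))) (cong ⟦_⟧ (μ≗ν _))
  ... | no  _ = μ≗ν _

  -- Translates, in both directions, between the left/right and the heel/toe form of the condition.
  foot≡ : ∀ s (h : Fin n → Sign) j a b →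
    Foot s (h (lo j)) (h (hi j)) a b ≡
    (⟦ h (beside s j) ⟧ ≡ ⟦ a ⟧ + ⟦ h (beside (opposite s) j) ⟧ + ⟦ b ⟧)
  foot≡ Sign.+ h j a b = refl
  foot≡ Sign.- h j a b = refl

  heel-of-pair : ∀ i j p → heelPiece i j ≡ hi (lo p) → j ≡ lo p ⊎ j ≡ hi p
  heel-of-pair i j p = go (heelSide i j)
    where
    go : ∀ s → beside s j ≡ hi (lo p) → j ≡ lo p ⊎ j ≡ hi p
    go Sign.+ eq = inj₁ (hi-injective {n} eq)
    go Sign.- eq = inj₂ (lo-injective {n} (trans eq (sym (lo∘hi≡hi∘lo {n} p))))

  -- Toe sums of opposite sign would add up to 0, which is not ±2.
  toeSums-agree : ∀ {μ i p} → WaterbombValid μ i p →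
    ⟦ sign (toeSum μ i (lo p)) ⟧ ≡ toeSum μ i (lo p) ×
    ⟦ sign (toeSum μ i (lo p)) ⟧ ≡ toeSum μ i (hi p)
  toeSums-agree (inj₁ x , inj₁ y , _)      rewrite x | y = refl , refl
  toeSums-agree (inj₂ x , inj₂ y , _)      rewrite x | y = refl , refl
  toeSums-agree (inj₁ x , inj₂ y , inj₁ z) rewrite x | y = contradiction z λ ()
  toeSums-agree (inj₁ x , inj₂ y , inj₂ z) rewrite x | y = contradiction z λ ()
  toeSums-agree (inj₂ x , inj₁ y , inj₁ z) rewrite x | y = contradiction z λ ()
  toeSums-agree (inj₂ x , inj₁ y , inj₂ z) rewrite x | y = contradiction z λ ()

  waterbombValid : ∀ {μ i p} h → ⟦ h ⟧ ≡ toeSum μ i (lo p) → ⟦ h ⟧ ≡ toeSum μ i (hi p) →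
                   WaterbombValid μ i p
  waterbombValid Sign.+ x y rewrite sym x | sym y = inj₁ refl , inj₁ refl , inj₁ refl
  waterbombValid Sign.- x y rewrite sym x | sym y = inj₂ refl , inj₂ refl , inj₂ refl

  -- If the heel is a crease, this is the foot's own condition. Otherwise the foot is the left or
  -- the right half of a waterbomb vertex, and both toe sums equal the restored heel.
  heel-of-foot : ∀ {μ} → LocallyValid μ → ∀ i j → ⟦ piece μ i (heelPiece i j) ⟧ ≡ toeSum μ i j
  heel-of-foot {μ} (feet , waterbombs) i j with contracted? i (heelPiece i j)
  ... | no  present = feet i j present
  ... | yes (p , wb , eq) with heel-of-pair i j p eq
  ...   | inj₁ refl = proj₁ (toeSums-agree {μ} {i} {p} (waterbombs i p wb))
  ...   | inj₂ refl = proj₂ (toeSums-agree {μ} {i} {p} (waterbombs i p wb))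

  split : MVAssignment → Grid m n → Sign
  split μ (inj₁ (j , t)) = μ (zigzag j t)
  split μ (inj₂ (i , k)) = piece μ i k

  split-feet : ∀ {μ} → LocallyValid μ → Feet m n ε (split μ)
  split-feet {μ} valid i j = subst id (sym (foot≡ (heelSide i j) (piece μ i) j _ _))
    (trans (heel-of-foot valid i j)
      -- A middle toe is never contracted, so `piece` returns its value under `μ`.
      (cong (λ s → value μ (zigzag j (lo i)) + ⟦ s ⟧ + value μ (zigzag j (hi i)))
        (sym (piece-present μ i (middleToePiece i j) (middleToe-not-contracted i j)))))

  -- Forgets the values on contracted pieces; the foot conditions determine them, which makes this
  -- invertible.
  merge : (Grid m n → Sign) → MVAssignment
  merge G (zigzag j t)       = G (inj₁ (j , t))
  merge G (horizontal i k _) = G (inj₂ (i , k))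

  heel-merge : ∀ G → Feet m n ε G → ∀ i j →
    ⟦ G (inj₂ (i , heelPiece i j)) ⟧ ≡ toeSum (merge G) i j
  heel-merge G feet i j =
    subst id (foot≡ (heelSide i j) (λ k → G (inj₂ (i , k))) j _ _) (feet i j)

  heel-merge-lo : ∀ G → Feet m n ε G → ∀ i p → Waterbomb i p →
    ⟦ G (inj₂ (i , hi (lo p))) ⟧ ≡ toeSum (merge G) i (lo p)
  heel-merge-lo G feet i p (_ , eq) =
    subst (λ s → ⟦ G (inj₂ (i , beside s (lo p))) ⟧ ≡ toeSum (merge G) i (lo p)) eq
      (heel-merge G feet i (lo p))

  -- The right foot of the pair has its heel on the left, on the piece `lo (hi p)`, which is also
  -- the heel of the left foot.
  heel-merge-hi : ∀ G → Feet m n ε G → ∀ i p → Waterbomb i p →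
    ⟦ G (inj₂ (i , hi (lo p))) ⟧ ≡ toeSum (merge G) i (hi p)
  heel-merge-hi G feet i p wb =
    subst (λ k → ⟦ G (inj₂ (i , k)) ⟧ ≡ toeSum (merge G) i (hi p)) (lo∘hi≡hi∘lo {n} p)
      (subst (λ s → ⟦ G (inj₂ (i , beside s (hi p))) ⟧ ≡ toeSum (merge G) i (hi p))
        (heelSide-hi i p wb)
        (heel-merge G feet i (hi p)))

  merge-valid : ∀ G → Feet m n ε G → LocallyValid (merge G)
  merge-valid G feet =
      (λ i j _ → heel-merge G feet i j)
    , λ i p wb → waterbombValid {merge G} {i} {p} (G (inj₂ (i , hi (lo p))))
                   (heel-merge-lo G feet i p wb) (heel-merge-hi G feet i p wb)

  -- A forgotten heel value equals the toe sum of its left foot, from which `piece` reads it back.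
  piece-merge : ∀ G → Feet m n ε G → ∀ i k → piece (merge G) i k ≡ G (inj₂ (i , k))
  piece-merge G feet i k with contracted? i k
  ... | no  _ = refl
  ... | yes (p , wb , refl) =
    trans (cong sign (sym (heel-merge-lo G feet i p wb))) (sign-◃ (G (inj₂ (i , k))) 1)

  split-cong : ∀ {μ ν} → μ ≗ ν → split μ ≗ split ν
  split-cong μ≗ν (inj₁ _)       = μ≗ν _
  split-cong μ≗ν (inj₂ (i , k)) = piece-cong μ≗ν i k

  split-merge : ∀ G → Feet m n ε G → split (merge G) ≗ G
  split-merge G feet (inj₁ _)       = refl
  split-merge G feet (inj₂ (i , k)) = piece-merge G feet i k

  merge-cong : ∀ {G H} → G ≗ H → merge G ≗ merge H
  merge-cong G≗H (zigzag _ _)       = G≗H _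
  merge-cong G≗H (horizontal _ _ _) = G≗H _

  merge-split : ∀ μ → merge (split μ) ≗ μ
  merge-split μ (zigzag _ _)             = refl
  merge-split μ (horizontal i k present) = piece-present μ i k present

  splitting : Inverse (LocallyValidAssignments S) (FeetSetoid m n ε)
  splitting = record
    { to        = λ (μ , valid) → split μ , split-feet valid
    ; from      = λ (G , feet) → merge G , merge-valid G feet
    ; to-cong   = split-cong
    ; from-cong = merge-cong
    ; inverse   = (λ {(G , feet)} eq x → trans (split-cong eq x) (split-merge G feet x))
                , λ {(μ , _)} eq c → trans (merge-cong eq c) (merge-split μ c)
    }

theorem7 : (m n : ℕ) .{{_ : NonZero m}} .{{_ : NonZero n}} →
    (S : SnakeTessellation m n) →
    (σ : Fin (pred n) → Sign) → AllEqual σ →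
    (ε : Fin (pred n) → Sign) →
    ∃[ N ] LocallyValidAssignments S HasCardinality N
    × LocallyValidAssignments (modifiedMiura m {n} σ) HasCardinality N
    × LocallyValidAssignments (modifiedMiura m {n} ε) HasCardinality N
theorem7 m n S σ _ ε = N , cardinality S , cardinality _ , cardinality _
  where
  -- All signs are reflected to +, so this number depends on `m` and `n` only.
  N = proj₁ (count-feet m n (λ _ → Sign.+))
  cardinality : (T : SnakeTessellation m n) → LocallyValidAssignments T HasCardinality N
  cardinality T = compose (Split.splitting T)
    (compose (reflect m n (SnakeTessellation.ε T)) (proj₂ (count-feet m n (λ _ → Sign.+))))
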